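{- Let $L$ be a finite ranked meet-semilattice with rank function $r$. If $L$ admits an ideal decomposition $\mathcal{I}=\{I_1,I_2,\ldots,I_m\}$, then \[ \chi(L,t)=t^{c}\prod_{i=1}^{m}\chi(I_i,t),\qquad\text{where } c=r(L)-\sum_{i=1}^{m}r(I_i). \]
   Context: A finite meet-semilattice $L$ (with minimum $\hat 0$) is ranked if there is $r:L\to\mathbb{N}$ with $r(\hat 0)=0$ and $r(y)=r(x)+1$ whenever $y$ covers $x$. An ideal of $L$ is a nonempty downward closed subset; it inherits the restricted rank function. For $P=L$ or $P$ an ideal of $L$, put $r(P)=\max_{x\in P}r(x)$ and $\chi(P,t)=\sum_{x\in P}\mu(\hat 0,x)\,t^{r(P)-r(x)}$, where $\mu$ is the Möbius function (for $x$ in an ideal, $\mu(\hat 0,x)$ computed in the ideal and in $L$ agree). For $x\in L$, $\langle x\rangle=\{y\in L: y\le x\}$ is the principal ideal generated by $x$; it is nontrivial if $x\ne\hat 0$. A collection $\{I_1,\ldots,I_m\}$ of ideals of $L$ is an ideal decomposition of $L$ if: (I1) for every $x\in L\setminus\{\hat 0\}$ there is $j\in\{1,\dots,m\}$ such that $I_j\cap\langle x\rangle$ is a nontrivial principal ideal of $L$; (I2) for every choice $x_i\in I_i$ ($1\le i\le m$) the join $x_1\vee\cdots\vee x_m$ exists in $L$; (I3) for every such choice, $r(x_1\vee\cdots\vee x_m)=\sum_{i=1}^m r(x_i)$. -}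

module Defs where

open import Data.Fin.Base using (Fin)
import Data.Fin.Induction as Fin
import Data.Fin.Properties as Fin
open import Data.Integer.Base using (ℤ; 0ℤ; 1ℤ) renaming (_+_ to _+ℤ_; _*_ to _*ℤ_; -_ to -ℤ_)
open import Data.Integer.Properties using (+-identityˡ)
open import Data.List.Base using (List; []; _∷_; _++_; map; filter; foldr; replicate; tabulate)
open import Data.List.Extrema.Nat using (max)
open import Data.List.Properties using (map-cong)
open import Data.Nat.Base using (ℕ; zero; suc; _∸_)
open import Data.Nat.ListAction using (sum)
open import Data.Product.Base using (_×_; _,_; ∃-syntax)
open import Function.Bundles using (_↔_; Inverse)
open import Function.Properties.Inverse using (Inverse⇒Injection)
open import Induction.WellFounded using (WellFounded; Acc; acc; module Subrelation)
import Level
open import Level using (_⊔_)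
import Relation.Binary.Construct.NonStrictToStrict as ToStrict
import Relation.Binary.Construct.On as On
open import Relation.Binary.Core using (Rel)
open import Relation.Binary.Definitions using (Minimum; DecidableEquality) renaming (Decidable to Decidable₂)
open import Relation.Binary.Lattice.Structures using (IsMeetSemilattice)
open import Relation.Binary.PropositionalEquality
  using (_≡_; _≢_; refl; sym; trans; cong; cong₂; subst; subst₂)
open import Relation.Nullary.Decidable.Core using (Dec; yes; no; _×-dec_; map′)
open import Relation.Nullary.Negation.Core using (¬_; contradiction)
open import Relation.Unary using (Pred; Decidable; _∈_; _∩_; _≐_; Satisfiable)

-- Coefficient lists, constant coefficient first.  Trailing zeros are
-- allowed, so equality of polynomials is _≈ₚ_ and not _≡_.
Poly : Set
Poly = List ℤ

coeff : Poly → ℕ → ℤ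
coeff []      _       = 0ℤ
coeff (a ∷ _) zero    = a
coeff (_ ∷ p) (suc k) = coeff p k

infix 4 _≈ₚ_
_≈ₚ_ : Poly → Poly → Set
p ≈ₚ q = ∀ k → coeff p k ≡ coeff q k

infixl 6 _+ₚ_
_+ₚ_ : Poly → Poly → Poly
[]      +ₚ q       = q
(a ∷ p) +ₚ []      = a ∷ p
(a ∷ p) +ₚ (b ∷ q) = (a +ℤ b) ∷ (p +ₚ q)

infixl 7 _*ₚ_
_*ₚ_ : Poly → Poly → Poly
[]      *ₚ q = []
(a ∷ p) *ₚ q = map (a *ℤ_) q +ₚ (0ℤ ∷ (p *ₚ q))

infix 8 _·t^_
_·t^_ : ℤ → ℕ → Poly
a ·t^ k = replicate k 0ℤ ++ (a ∷ [])

infix 8 t^_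
t^_ : ℕ → Poly
t^ k = 1ℤ ·t^ k

∑ℤ : List ℤ → ℤ
∑ℤ = foldr _+ℤ_ 0ℤ

∑ₚ : List Poly → Poly
∑ₚ = foldr _+ₚ_ []

∏ₚ : ∀ {m} → (Fin m → Poly) → Poly
∏ₚ f = foldr _*ₚ_ (1ℤ ∷ []) (tabulate f)

∑ℕ : ∀ {m} → (Fin m → ℕ) → ℕ
∑ℕ f = sum (tabulate f)

-- Decidability of _≡_ and _≤_ is derived below from finiteness and the
-- existence of meets.
record FiniteMeetSemilattice a ℓ : Set (Level.suc (a ⊔ ℓ)) where
  infix  4 _≤_
  infixr 7 _∧_
  field
    Carrier           : Set a
    _≤_               : Rel Carrier ℓ
    _∧_               : Carrier → Carrier → Carrier
    isMeetSemilattice : IsMeetSemilattice _≡_ _≤_ _∧_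
    0̂                 : Carrier
    minimum           : Minimum _≤_ 0̂
    size              : ℕ
    finite            : Carrier ↔ Fin size

  open IsMeetSemilattice isMeetSemilattice public
    hiding (refl; trans)
    renaming (reflexive to ≤-reflexive)
  open IsMeetSemilattice isMeetSemilattice public
    using () renaming (refl to ≤-refl; trans to ≤-trans)
  open ToStrict _≡_ _≤_ public using (_<_)

  elements : List Carrier
  elements = tabulate (Inverse.from finite)

  infix 4 _≟_ _≤?_ _<?_
  _≟_ : DecidableEquality Carrier
  _≟_ = Fin.inj⇒≟ (Inverse⇒Injection finite)

  _≤?_ : Decidable₂ _≤_
  x ≤? y = map′
    (λ x∧y≡x → subst (_≤ y) x∧y≡x (x∧y≤y x y))
    (λ x≤y → antisym (x∧y≤x x y) (∧-greatest ≤-refl x≤y))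
    (x ∧ y ≟ x)

  _<?_ : Decidable₂ _<_
  _<?_ = ToStrict.<-decidable _≡_ _≤_ _≟_ _≤?_

  <-wellFounded : WellFounded _<_
  <-wellFounded = Subrelation.wellFounded
    (λ {x} {y} → subst₂ _<_ (sym (inv x)) (sym (inv y)))
    (On.wellFounded to
      (Fin.spo-wellFounded
        (On.isStrictPartialOrder from
          (ToStrict.<-isStrictPartialOrder _≡_ _≤_ isPartialOrder))))
    where
    open Inverse finite using (to; from; strictlyInverseʳ)
    inv : ∀ x → from (to x) ≡ x
    inv = strictlyInverseʳ

  infix 4 _⋖_
  _⋖_ : Rel Carrier (a ⊔ ℓ)
  x ⋖ y = x < y × ¬ (∃[ z ] x < z × z < y)

  ⟨_⟩ : Carrier → Pred Carrier ℓ
  ⟨ x ⟩ y = y ≤ x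

  IsJoin : ∀ {m} → (Fin m → Carrier) → Carrier → Set (a ⊔ ℓ)
  IsJoin x j = (∀ i → x i ≤ j) × (∀ u → (∀ i → x i ≤ u) → j ≤ u)

  IsNontrivialPrincipal : ∀ {p} → Pred Carrier p → Set (a ⊔ ℓ ⊔ p)
  IsNontrivialPrincipal S = ∃[ y ] y ≢ 0̂ × S ≐ ⟨ y ⟩

  -- The Möbius function.  μ-refl and μ-rec below are its usual defining
  -- equations; the sum in μ-rec is empty, so μ x y is 0, unless x ≤ y.
  mutual
    μ-acc : ∀ x y → Acc _<_ y → ℤ
    μ-acc x y (acc rs) with x ≟ y
    ... | yes _ = 1ℤ
    ... | no  _ = -ℤ ∑ℤ (map (λ z → μ-term x y rs z (x ≤? z ×-dec z <? y)) elements)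

    μ-term : ∀ x y → (∀ {z} → z < y → Acc _<_ z) → ∀ z → Dec (x ≤ z × z < y) → ℤ
    μ-term x y rs z (yes (_ , z<y)) = μ-acc x z (rs z<y)
    μ-term x y rs z (no _)          = 0ℤ

  μ : Carrier → Carrier → ℤ
  μ x y = μ-acc x y (<-wellFounded y)

  mutual
    μ-acc-irrelevant : ∀ x y (p q : Acc _<_ y) → μ-acc x y p ≡ μ-acc x y q
    μ-acc-irrelevant x y (acc rs) (acc rs′) with x ≟ y
    ... | yes _ = refl
    ... | no  _ = cong (λ zs → -ℤ ∑ℤ zs)
      (map-cong (λ z → μ-term-irrelevant x y rs rs′ z (x ≤? z ×-dec z <? y)) elements)

    μ-term-irrelevant : ∀ x y (rs rs′ : ∀ {z} → z < y → Acc _<_ z) z d →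
                        μ-term x y rs z d ≡ μ-term x y rs′ z d
    μ-term-irrelevant x y rs rs′ z (yes (_ , z<y)) = μ-acc-irrelevant x z (rs z<y) (rs′ z<y)
    μ-term-irrelevant x y rs rs′ z (no _)          = refl

  μ-refl : ∀ x → μ x x ≡ 1ℤ
  μ-refl x with <-wellFounded x
  ... | acc rs with x ≟ x
  ...   | yes _   = refl
  ...   | no  x≢x = contradiction refl x≢x

  μ-rec : ∀ {x y} → x ≢ y →
          μ x y ≡ -ℤ ∑ℤ (map (μ x) (filter (λ z → x ≤? z ×-dec z <? y) elements))
  μ-rec {x} {y} x≢y with <-wellFounded y
  ... | acc rs with x ≟ y
  ...   | yes x≡y = contradiction x≡y x≢y
  ...   | no  _   = cong -ℤ_ (go (λ z → x ≤? z ×-dec z <? y) elements)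
    where
    go : (d : Decidable (λ z → x ≤ z × z < y)) → ∀ zs →
         ∑ℤ (map (λ z → μ-term x y rs z (d z)) zs) ≡ ∑ℤ (map (μ x) (filter d zs))
    go d []       = refl
    go d (z ∷ zs) with d z
    ... | yes (_ , z<y) = cong₂ _+ℤ_ (μ-acc-irrelevant x z (rs z<y) (<-wellFounded z)) (go d zs)
    ... | no  _         = trans (+-identityˡ _) (go d zs)

module _ {a ℓ} (L : FiniteMeetSemilattice a ℓ) where
  open FiniteMeetSemilattice L

  record Ideal p : Set (a ⊔ ℓ ⊔ Level.suc p) where
    field
      member     : Pred Carrier p
      member?    : Decidable member
      nonempty   : Satisfiable member
      downClosed : ∀ {x y} → y ≤ x → x ∈ member → y ∈ member

  record IsRank (r : Carrier → ℕ) : Set (a ⊔ ℓ) where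
    field
      rank-0̂ : r 0̂ ≡ 0
      rank-⋖ : ∀ {x y} → x ⋖ y → r y ≡ suc (r x)

  module _ (r : Carrier → ℕ) where

    -- The default value 0 of max is harmless: P is only ever L or an
    -- ideal, hence nonempty, and ranks are natural numbers.
    rankOf : ∀ {p} {P : Pred Carrier p} → Decidable P → ℕ
    rankOf P? = max 0 (map r (filter P? elements))

    -- Since P is down-closed, the intervals [ 0̂ , x ] with x ∈ P are the
    -- same in P and in L, and μ of L is the Möbius function of P.
    -- r x ≤ rankOf P? for x ∈ P, so no exponent is truncated.
    χ : ∀ {p} {P : Pred Carrier p} → Decidable P → Poly
    χ P? = ∑ₚ (map (λ x → μ 0̂ x ·t^ (rankOf P? ∸ r x)) (filter P? elements))

    record IsIdealDecomposition {m p} (I : Fin m → Ideal p) : Set (a ⊔ ℓ ⊔ p) where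
      field
        I1 : ∀ x → x ≢ 0̂ → ∃[ j ] IsNontrivialPrincipal (Ideal.member (I j) ∩ ⟨ x ⟩)
        I2 : ∀ x → (∀ i → x i ∈ Ideal.member (I i)) → ∃[ j ] IsJoin x j
        I3 : ∀ x → (∀ i → x i ∈ Ideal.member (I i)) →
             ∀ j → IsJoin x j → r j ≡ ∑ℕ (λ i → r (x i))

-- Give each tuple t with t i ∈ I i the signed mass ∏ᵢ μ 0̂ (t i).  The tuples
-- with join ≤ x have total mass ∏ᵢ ∑ { μ 0̂ y ∣ y ∈ I i, y ≤ x }; if x ≢ 0̂,
-- the factor singled out by (I1) is the sum of μ 0̂ over some ⟨ y ⟩ with y ≢
-- 0̂, hence 0.  So the pushforward of the mass along the join has the same
-- sums over principal ideals as μ 0̂, and equals it by Möbius inversion.  By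
-- (I3) the join adds ranks, which turns this equality into the factorisation
-- of χ.
module Submission where

open import Defs
open import Algebra.Bundles using (AbelianGroup)
import Algebra.Properties.CommutativeMonoid.Sum as CommutativeMonoidSum
import Algebra.Properties.Group as GroupProperties
import Algebra.Properties.Semiring.Sum as SemiringSum
open import Data.Bool.Base using (if_then_else_)
open import Data.Fin.Base using (Fin; zero; suc)
import Data.Fin.Properties as Fin
open import Data.Integer.Base using (ℤ; 0ℤ; 1ℤ; +_; _-_; -_; _+_; _*_)
import Data.Integer.Properties as ℤ
open import Data.Integer.Tactic.RingSolver using (solve-∀)
open import Data.List.Base using ([]; _∷_; map; filter; tabulate)
open import Data.List.Extrema.Nat using (xs≤max; argmax-sel)
import Data.List.Membership.Propositional as List
open import Data.List.Membership.Propositional.Properties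
  using (∈-map⁺; ∈-map⁻; ∈-filter⁺; ∈-filter⁻; ∈-tabulate⁺)
open import Data.List.Properties using (tabulate-cong)
import Data.List.Relation.Unary.All as All
open import Data.Nat.Base as ℕ using (ℕ; zero; suc; _∸_)
open import Data.Nat.ListAction using (sum)
import Data.Nat.Properties as ℕ
open import Data.Nat.Tactic.RingSolver renaming (solve-∀ to solveℕ-∀)
open import Data.Product.Base using (_×_; _,_; ∃-syntax; proj₁; proj₂)
open import Data.Sum.Base using (inj₁; inj₂)
open import Data.Unit.Base using (tt)
import Data.Vec.Functional as Vector
open import Function.Base using (_∘_; id)
open import Function.Bundles using (Inverse)
open import Induction.WellFounded using (Acc; acc)
open import Relation.Binary.PropositionalEquality
  using (_≡_; _≢_; _≗_; refl; sym; trans; cong; cong₂; subst; module ≡-Reasoning)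
open import Relation.Nullary.Decidable using (Dec; does; yes; no; _×-dec_; dec-true; dec-false)
open import Relation.Nullary.Negation.Core using (¬_; contradiction)
open import Relation.Unary using (Pred; Decidable)
open import Relation.Unary.Properties using (U?)

open SemiringSum ℤ.+-*-semiring
  using ( sum-cong-≗; sum-remove; sum-replicate-zero; ∑-comm; ∑-distrib-+
        ; *-distribˡ-sum; *-distribʳ-sum)
  renaming (sum to sumℤ)
open GroupProperties (AbelianGroup.group ℤ.+-0-abelianGroup) using (∙-cancelʳ)
open CommutativeMonoidSum ℤ.*-1-commutativeMonoid
  using ()
  renaming (sum to ∏; sum-remove to ∏-remove)

-- Indicators, and finite sums and products of integers.

𝟏 : ∀ {a} {A : Set a} → Dec A → ℤ
𝟏 d = if does d then 1ℤ else 0ℤ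

module _ {a} {A : Set a} (d : Dec A) where

  𝟏-true : A → 𝟏 d ≡ 1ℤ
  𝟏-true x = cong (if_then 1ℤ else 0ℤ) (dec-true d x)

  𝟏-false : ¬ A → 𝟏 d ≡ 0ℤ
  𝟏-false ¬x = cong (if_then 1ℤ else 0ℤ) (dec-false d ¬x)

  𝟏-cong : ∀ {b} {B : Set b} (e : Dec B) → (A → B) → (B → A) → 𝟏 d ≡ 𝟏 e
  𝟏-cong (yes y) f g = 𝟏-true (g y)
  𝟏-cong (no ¬y) f g = 𝟏-false (¬y ∘ f)

  𝟏-*-false : ∀ u → ¬ A → 𝟏 d * u ≡ 0ℤ
  𝟏-*-false u ¬x = trans (cong (_* u) (𝟏-false ¬x)) (ℤ.*-zeroˡ u)

𝟏-*-cong : ∀ {a} {A : Set a} (d : Dec A) u v → (A → u ≡ v) → 𝟏 d * u ≡ 𝟏 d * v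
𝟏-*-cong (yes x) u v u≡v = cong (1ℤ *_) (u≡v x)
𝟏-*-cong (no _)  u v u≡v = trans (ℤ.*-zeroˡ u) (sym (ℤ.*-zeroˡ v))

𝟏-× : ∀ {a b} {A : Set a} {B : Set b} (d : Dec A) (e : Dec B) → 𝟏 (d ×-dec e) ≡ 𝟏 d * 𝟏 e
𝟏-× (yes _) (yes _) = refl
𝟏-× (yes _) (no _)  = refl
𝟏-× (no _)  _       = refl

sum-single : ∀ {n} (f : Fin n → ℤ) k → (∀ i → i ≢ k → f i ≡ 0ℤ) → sumℤ f ≡ f k
sum-single {suc n} f k f≡0 = begin
  sumℤ f                            ≡⟨ sum-remove {i = k} f ⟩
  f k + sumℤ (Vector.removeAt f k)  ≡⟨ cong (_+_ (f k)) (sum-cong-≗ λ j → f≡0 _ (Fin.punchInᵢ≢i k j)) ⟩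
  f k + sumℤ {n} (λ _ → 0ℤ)         ≡⟨ cong (_+_ (f k)) (sum-replicate-zero n) ⟩
  f k + 0ℤ                          ≡⟨ ℤ.+-identityʳ (f k) ⟩
  f k                               ∎
  where open ≡-Reasoning

∏-zero : ∀ {n} (f : Fin n → ℤ) k → f k ≡ 0ℤ → ∏ f ≡ 0ℤ
∏-zero {suc n} f k fk≡0 = trans (∏-remove {i = k} f)
  (trans (cong (_* ∏ (Vector.removeAt f k)) fk≡0) (ℤ.*-zeroˡ (∏ (Vector.removeAt f k))))

∏-one : ∀ {n} (f : Fin n → ℤ) → (∀ i → f i ≡ 1ℤ) → ∏ f ≡ 1ℤ
∏-one {zero}  f f≡1 = refl
∏-one {suc n} f f≡1 = cong₂ _*_ (f≡1 zero) (∏-one (f ∘ suc) (f≡1 ∘ suc))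

∏-𝟏 : ∀ {n p} {P : Pred (Fin n) p} (P? : Decidable P) (d : Dec (∀ i → P i)) →
      𝟏 d ≡ ∏ (λ i → 𝟏 (P? i))
∏-𝟏 P? d with d
... | yes ∀P = sym (∏-one _ λ i → 𝟏-true (P? i) (∀P i))
... | no ¬∀P with Fin.¬∀⟶∃¬ _ _ P? ¬∀P
...   | k , ¬Pk = sym (∏-zero _ k (𝟏-false (P? k) ¬Pk))

-- Bridges the filtered list sums in `χ` and `μ-rec` to sums over `Fin n`, for which interchange and
-- distributivity are available.
∑ℤ-filter-tabulate : ∀ {a p n} {A : Set a} {P : Pred A p} (P? : Decidable P)
                     (g : A → ℤ) (f : Fin n → A) →
                     ∑ℤ (map g (filter P? (tabulate f))) ≡ sumℤ (λ i → 𝟏 (P? (f i)) * g (f i))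
∑ℤ-filter-tabulate {n = zero}  P? g f = refl
∑ℤ-filter-tabulate {n = suc n} P? g f with P? (f zero) | ∑ℤ-filter-tabulate P? g (f ∘ suc)
... | yes _ | eq = cong₂ _+_ (sym (ℤ.*-identityˡ (g (f zero)))) eq
... | no _  | eq = trans eq (sym (trans
  (cong (_+ sumℤ (λ i → 𝟏 (P? (f (suc i))) * g (f (suc i)))) (ℤ.*-zeroˡ (g (f zero))))
  (ℤ.+-identityˡ _)))

∑ℕ-cong : ∀ {m} {f g : Fin m → ℕ} → f ≗ g → ∑ℕ f ≡ ∑ℕ g
∑ℕ-cong f≗g = cong sum (tabulate-cong f≗g)

-- The subtrahend is added back on the left, which keeps truncated subtraction out of later
-- calculations.
∑ℕ-∸ : ∀ {m} {f g : Fin m → ℕ} → (∀ i → g i ℕ.≤ f i) →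
       ∑ℕ (λ i → f i ∸ g i) ℕ.+ ∑ℕ g ≡ ∑ℕ f
∑ℕ-∸ {zero}          g≤f = refl
∑ℕ-∸ {suc m} {f} {g} g≤f = begin
  (f₀ ∸ g₀ ℕ.+ ∑ℕ (λ i → f (suc i) ∸ g (suc i))) ℕ.+ (g₀ ℕ.+ ∑ℕ (g ∘ suc))
    ≡⟨ interchange (f₀ ∸ g₀) _ g₀ _ ⟩
  (f₀ ∸ g₀ ℕ.+ g₀) ℕ.+ (∑ℕ (λ i → f (suc i) ∸ g (suc i)) ℕ.+ ∑ℕ (g ∘ suc))
    ≡⟨ cong₂ ℕ._+_ (ℕ.m∸n+n≡m (g≤f zero)) (∑ℕ-∸ (g≤f ∘ suc)) ⟩
  f₀ ℕ.+ ∑ℕ (f ∘ suc)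
    ∎
  where
  open ≡-Reasoning
  f₀ = f zero
  g₀ = g zero
  interchange : ∀ u v x y → (u ℕ.+ v) ℕ.+ (x ℕ.+ y) ≡ (u ℕ.+ x) ℕ.+ (v ℕ.+ y)
  interchange = solveℕ-∀

-- Polynomials tested by linear functionals.

-- The linear functional sending t^k to h k.  It computes products without
-- any convolution (pair-*), and coefficients are special cases (coeff-pair).
pair : Poly → (ℕ → ℤ) → ℤ
pair []      h = 0ℤ
pair (a ∷ p) h = a * h zero + pair p (h ∘ suc)

pair-cong : ∀ p {g h} → g ≗ h → pair p g ≡ pair p h
pair-cong []      g≗h = refl
pair-cong (a ∷ p) g≗h = cong₂ _+_ (cong (a *_) (g≗h zero)) (pair-cong p (g≗h ∘ suc))

pair-zero : ∀ p → pair p (λ _ → 0ℤ) ≡ 0ℤ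
pair-zero []      = refl
pair-zero (a ∷ p) = cong₂ _+_ (ℤ.*-zeroʳ a) (pair-zero p)

pair-+ : ∀ p q h → pair (p +ₚ q) h ≡ pair p h + pair q h
pair-+ []      q       h = sym (ℤ.+-identityˡ _)
pair-+ (a ∷ p) []      h = sym (ℤ.+-identityʳ _)
pair-+ (a ∷ p) (b ∷ q) h =
  trans (cong (_+_ ((a + b) * h zero)) (pair-+ p q (h ∘ suc))) (lemma a b (h zero) _ _)
  where
  lemma : ∀ a b u v w → (a + b) * u + (v + w) ≡ (a * u + v) + (b * u + w)
  lemma = solve-∀

pair-scale : ∀ a q h → pair (map (a *_) q) h ≡ a * pair q h
pair-scale a []      h = sym (ℤ.*-zeroʳ a)
pair-scale a (b ∷ q) h =
  trans (cong (_+_ (a * b * h zero)) (pair-scale a q (h ∘ suc))) (lemma a b (h zero) _)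
  where
  lemma : ∀ a b u v → a * b * u + a * v ≡ a * (b * u + v)
  lemma = solve-∀

-- On monomials this is t^i t^j = t^(i+j), and both sides are bilinear. The induction on `p` varies
-- `h`, because the tail of `p` is paired with `h ∘ suc`.
pair-* : ∀ p q h → pair (p *ₚ q) h ≡ pair p (λ i → pair q (λ j → h (i ℕ.+ j)))
pair-* []      q h = refl
pair-* (a ∷ p) q h = begin
  pair (map (a *_) q +ₚ (0ℤ ∷ p *ₚ q)) h
    ≡⟨ pair-+ (map (a *_) q) _ h ⟩
  pair (map (a *_) q) h + (0ℤ * h zero + pair (p *ₚ q) (h ∘ suc))
    ≡⟨ cong₂ _+_ (pair-scale a q h)
         (trans (cong (_+ pair (p *ₚ q) (h ∘ suc)) (ℤ.*-zeroˡ (h zero))) (ℤ.+-identityˡ _)) ⟩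
  a * pair q h + pair (p *ₚ q) (h ∘ suc)
    ≡⟨ cong (_+_ (a * pair q h)) (pair-* p q (h ∘ suc)) ⟩
  a * pair q h + pair p (λ i → pair q (λ j → h (suc (i ℕ.+ j))))
    ∎
  where open ≡-Reasoning

pair-·t^ : ∀ a k h → pair (a ·t^ k) h ≡ a * h k
pair-·t^ a zero    h = ℤ.+-identityʳ _
pair-·t^ a (suc k) h = trans (cong (_+ pair (a ·t^ k) (h ∘ suc)) (ℤ.*-zeroˡ (h zero)))
  (trans (ℤ.+-identityˡ _) (pair-·t^ a k (h ∘ suc)))

pair-∑ₚ : ∀ {a} {A : Set a} (f : A → Poly) xs h →
          pair (∑ₚ (map f xs)) h ≡ ∑ℤ (map (λ x → pair (f x) h) xs)
pair-∑ₚ f []       h = refl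
pair-∑ₚ f (x ∷ xs) h = trans (pair-+ (f x) _ h) (cong (_+_ (pair (f x) h)) (pair-∑ₚ f xs h))

coeff-pair : ∀ p k → coeff p k ≡ pair p (λ j → 𝟏 (j ℕ.≟ k))
coeff-pair []      k       = refl
coeff-pair (a ∷ p) zero    = sym (trans (cong₂ _+_ (ℤ.*-identityʳ a) (pair-zero p)) (ℤ.+-identityʳ a))
-- `𝟏` looks only at `does`, and this agrees by computation for `suc j ℕ.≟ suc k` and `j ℕ.≟ k`, so
-- the induction hypothesis fits as it is.
coeff-pair (a ∷ p) (suc k) = sym (trans
  (cong₂ _+_ (ℤ.*-zeroʳ a) (sym (coeff-pair p k))) (ℤ.+-identityˡ _))

-- Turns an identity of polynomials into one of sums of integers with `h` arbitrary, so that
-- products can be expanded by `pair-*`.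
≈ₚ-pair : ∀ {p q} → (∀ h → pair p h ≡ pair q h) → p ≈ₚ q
≈ₚ-pair {p} {q} eq k = trans (coeff-pair p k) (trans (eq _) (sym (coeff-pair q k)))

-- Sums over the semilattice and Möbius inversion.

module _ {a ℓ} (L : FiniteMeetSemilattice a ℓ) where
  open FiniteMeetSemilattice L
  open Inverse finite using (to; from; strictlyInverseˡ; strictlyInverseʳ)

  ∑ : (Carrier → ℤ) → ℤ
  ∑ g = sumℤ (g ∘ from)

  ∑-cong : ∀ {f g : Carrier → ℤ} → f ≗ g → ∑ f ≡ ∑ g
  ∑-cong f≗g = sum-cong-≗ (f≗g ∘ from)

  ∑-single : ∀ f y → (∀ x → x ≢ y → f x ≡ 0ℤ) → ∑ f ≡ f y
  ∑-single f y f≡0 = trans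
    (sum-single (f ∘ from) (to y) λ i i≢ → f≡0 _ λ eq → i≢ (trans (sym (strictlyInverseˡ i)) (cong to eq)))
    (cong f (strictlyInverseʳ y))

  ∑-δ : ∀ y (g : Carrier → ℤ) → ∑ (λ x → 𝟏 (y ≟ x) * g x) ≡ g y
  ∑-δ y g = trans
    (∑-single (λ x → 𝟏 (y ≟ x) * g x) y λ x x≢y → 𝟏-*-false (y ≟ x) (g x) (x≢y ∘ sym))
    (trans (cong (_* g y) (𝟏-true (y ≟ y) refl)) (ℤ.*-identityˡ (g y)))

  ≤0̂⇒≡0̂ : ∀ {x} → x ≤ 0̂ → x ≡ 0̂
  ≤0̂⇒≡0̂ x≤0̂ = antisym x≤0̂ (minimum _)

  -- The zeta transform.
  ↓∑ : (Carrier → ℤ) → Carrier → ℤ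
  ↓∑ f x = ∑ (λ y → 𝟏 (y ≤? x) * f y)

  ↓∑-split : ∀ f x → ↓∑ f x ≡ f x + ∑ (λ y → 𝟏 (y <? x) * f y)
  ↓∑-split f x = begin
    ↓∑ f x
      ≡⟨ ∑-cong (λ y → trans (cong (_* f y) (𝟏-≤ y)) (ℤ.*-distribʳ-+ (f y) (𝟏 (x ≟ y)) (𝟏 (y <? x)))) ⟩
    ∑ (λ y → 𝟏 (x ≟ y) * f y + 𝟏 (y <? x) * f y)
      ≡⟨ ∑-distrib-+ _ (λ i → 𝟏 (from i <? x) * f (from i)) ⟩
    ∑ (λ y → 𝟏 (x ≟ y) * f y) + ∑ (λ y → 𝟏 (y <? x) * f y)
      ≡⟨ cong (_+ ∑ (λ y → 𝟏 (y <? x) * f y)) (∑-δ x f) ⟩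
    f x + ∑ (λ y → 𝟏 (y <? x) * f y)
      ∎
    where
    open ≡-Reasoning
    𝟏-≤ : ∀ y → 𝟏 (y ≤? x) ≡ 𝟏 (x ≟ y) + 𝟏 (y <? x)
    𝟏-≤ y with x ≟ y
    ... | yes refl = trans (𝟏-true (x ≤? x) ≤-refl)
                       (sym (cong₂ _+_ (𝟏-true (x ≟ x) refl) (𝟏-false (x <? x) λ x<x → proj₂ x<x refl)))
    ... | no x≢y   = trans (𝟏-cong (y ≤? x) (y <? x) (λ y≤x → y≤x , x≢y ∘ sym) proj₁)
                       (sym (trans (cong (_+ 𝟏 (y <? x)) (𝟏-false (x ≟ y) x≢y)) (ℤ.+-identityˡ _)))

  ↓∑-0̂ : ∀ f → ↓∑ f 0̂ ≡ f 0̂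
  ↓∑-0̂ f = trans
    (∑-single (λ y → 𝟏 (y ≤? 0̂) * f y) 0̂ λ y y≢0̂ → 𝟏-*-false (y ≤? 0̂) (f y) (y≢0̂ ∘ ≤0̂⇒≡0̂))
    (trans (cong (_* f 0̂) (𝟏-true (0̂ ≤? 0̂) ≤-refl)) (ℤ.*-identityˡ (f 0̂)))

  -- Möbius inversion, in the form of uniqueness. By well-founded induction the terms strictly below
  -- `x` agree; cancelling them leaves the values at `x`.
  ↓∑-injective : ∀ {f g} → ↓∑ f ≗ ↓∑ g → f ≗ g
  ↓∑-injective {f} {g} eq x = go x (<-wellFounded x)
    where
    go : ∀ x → Acc _<_ x → f x ≡ g x
    go x (acc rs) = ∙-cancelʳ (∑ (λ y → 𝟏 (y <? x) * f y)) (f x) (g x) (begin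
      f x + ∑ (λ y → 𝟏 (y <? x) * f y)  ≡⟨ ↓∑-split f x ⟨
      ↓∑ f x                            ≡⟨ eq x ⟩
      ↓∑ g x                            ≡⟨ ↓∑-split g x ⟩
      g x + ∑ (λ y → 𝟏 (y <? x) * g y)  ≡⟨ cong (_+_ (g x)) (∑-cong below) ⟨
      g x + ∑ (λ y → 𝟏 (y <? x) * f y)  ∎)
      where
      open ≡-Reasoning
      below : ∀ y → 𝟏 (y <? x) * f y ≡ 𝟏 (y <? x) * g y
      below y = 𝟏-*-cong (y <? x) (f y) (g y) λ y<x → go y (rs y<x)

  -- Away from `0̂`, the recursion for `μ` makes the top term cancel all the strictly lower ones.
  ↓∑-μ : ∀ x → ↓∑ (μ 0̂) x ≡ 𝟏 (x ≟ 0̂)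
  ↓∑-μ x with x ≟ 0̂
  ... | yes refl = trans (↓∑-0̂ (μ 0̂)) (trans (μ-refl 0̂) (sym (𝟏-true (0̂ ≟ 0̂) refl)))
  ... | no x≢0̂ = begin
    ↓∑ (μ 0̂) x
      ≡⟨ ↓∑-split (μ 0̂) x ⟩
    μ 0̂ x + ∑ (λ y → 𝟏 (y <? x) * μ 0̂ y)
      -- The condition `0̂ ≤ y` always holds; it is inserted to match the filter in `μ-rec`.
      ≡⟨ cong₂ _+_ (μ-rec (x≢0̂ ∘ sym)) (∑-cong λ y → cong (_* μ 0̂ y)
           (𝟏-cong (y <? x) (0̂ ≤? y ×-dec y <? x) (minimum y ,_) proj₂)) ⟩
    - ∑ℤ (map (μ 0̂) (filter (λ z → 0̂ ≤? z ×-dec z <? x) elements)) + ∑ (λ y → 𝟏 (0̂ ≤? y ×-dec y <? x) * μ 0̂ y)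
      ≡⟨ cong (λ s → - s + ∑ (λ y → 𝟏 (0̂ ≤? y ×-dec y <? x) * μ 0̂ y))
           (∑ℤ-filter-tabulate (λ z → 0̂ ≤? z ×-dec z <? x) (μ 0̂) from) ⟩
    - ∑ (λ y → 𝟏 (0̂ ≤? y ×-dec y <? x) * μ 0̂ y) + ∑ (λ y → 𝟏 (0̂ ≤? y ×-dec y <? x) * μ 0̂ y)
      ≡⟨ ℤ.+-inverseˡ (∑ (λ y → 𝟏 (0̂ ≤? y ×-dec y <? x) * μ 0̂ y)) ⟩
    0ℤ
      ≡⟨ 𝟏-false (x ≟ 0̂) x≢0̂ ⟨
    𝟏 (x ≟ 0̂)
      ∎
    where open ≡-Reasoning

  -- Weighted sums over tuples.

  -- ∑ₜ w H is the sum of (∏ᵢ w i (t i)) * H t over all t : Fin m → Carrier.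
  ∑ₜ : ∀ {m} → (Fin m → Carrier → ℤ) → ((Fin m → Carrier) → ℤ) → ℤ
  ∑ₜ {zero}  w H = H Vector.[]
  ∑ₜ {suc m} w H = ∑ (λ x → w zero x * ∑ₜ (w ∘ suc) (λ t → H (x Vector.∷ t)))

  -- A tuple with a vanishing weight contributes nothing. This lets facts about joins be applied to
  -- tuples of members only, where the join is meaningful.
  ∑ₜ-cong-support : ∀ {m} (w : Fin m → Carrier → ℤ) {G H} →
                    (∀ t → (∀ i → w i (t i) ≢ 0ℤ) → G t ≡ H t) → ∑ₜ w G ≡ ∑ₜ w H
  ∑ₜ-cong-support {zero}  w eq = eq _ λ ()
  ∑ₜ-cong-support {suc m} w {G} {H} eq = ∑-cong term
    where
    term : ∀ x → w zero x * ∑ₜ (w ∘ suc) (λ t → G (x Vector.∷ t)) ≡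
                 w zero x * ∑ₜ (w ∘ suc) (λ t → H (x Vector.∷ t))
    term x with w zero x ℤ.≟ 0ℤ
    -- Both halves meet at `0ℤ`, since `0ℤ * _` computes to it for any second factor.
    ... | yes w≡0 = trans (cong (_* ∑ₜ (w ∘ suc) (λ t → G (x Vector.∷ t))) w≡0)
                      (cong (_* ∑ₜ (w ∘ suc) (λ t → H (x Vector.∷ t))) (sym w≡0))
    ... | no w≢0  = cong (w zero x *_) (∑ₜ-cong-support (w ∘ suc) λ t supp →
                      eq (x Vector.∷ t) λ { zero → w≢0 ; (suc i) → supp i })

  ∑ₜ-cong : ∀ {m} (w : Fin m → Carrier → ℤ) {G H} → G ≗ H → ∑ₜ w G ≡ ∑ₜ w H
  ∑ₜ-cong w eq = ∑ₜ-cong-support w λ t _ → eq t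

  ∑ₜ-*ˡ : ∀ {m} (w : Fin m → Carrier → ℤ) c H → ∑ₜ w (λ t → c * H t) ≡ c * ∑ₜ w H
  ∑ₜ-*ˡ {zero}  w c H = refl
  ∑ₜ-*ˡ {suc m} w c H = trans
    (∑-cong λ x → trans (cong (w zero x *_) (∑ₜ-*ˡ (w ∘ suc) c (λ t → H (x Vector.∷ t)))) (swap (w zero x) c _))
    (sym (*-distribˡ-sum c (λ i → w zero (from i) * ∑ₜ (w ∘ suc) (λ t → H (from i Vector.∷ t)))))
    where
    swap : ∀ u v x → u * (v * x) ≡ v * (u * x)
    swap = solve-∀

  ∑ₜ-*ʳ : ∀ {m} (w : Fin m → Carrier → ℤ) c H → ∑ₜ w (λ t → H t * c) ≡ ∑ₜ w H * c
  ∑ₜ-*ʳ w c H = trans (∑ₜ-cong w λ t → ℤ.*-comm (H t) c) (trans (∑ₜ-*ˡ w c H) (ℤ.*-comm c _))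

  ∑ₜ-∑ : ∀ {m} (w : Fin m → Carrier → ℤ) (H : Carrier → (Fin m → Carrier) → ℤ) →
         ∑ (λ x → ∑ₜ w (H x)) ≡ ∑ₜ w (λ t → ∑ (λ x → H x t))
  ∑ₜ-∑ {zero}  w H = refl
  ∑ₜ-∑ {suc m} w H = trans
    (∑-comm λ i j → w zero (from j) * ∑ₜ (w ∘ suc) (λ t → H (from i) (from j Vector.∷ t)))
    (∑-cong λ y → trans
      (sym (*-distribˡ-sum (w zero y) λ i → ∑ₜ (w ∘ suc) (λ t → H (from i) (y Vector.∷ t))))
      (cong (w zero y *_) (∑ₜ-∑ (w ∘ suc) λ x t → H x (y Vector.∷ t))))

  -- The distributive law: a product of sums expands into a sum over all choices of one term from
  -- each factor.
  ∑ₜ-∏ : ∀ {m} (w h : Fin m → Carrier → ℤ) →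
         ∑ₜ w (λ t → ∏ (λ i → h i (t i))) ≡ ∏ (λ i → ∑ (λ x → h i x * w i x))
  ∑ₜ-∏ {zero}  w h = refl
  ∑ₜ-∏ {suc m} w h = begin
    ∑ (λ x → w zero x * ∑ₜ (w ∘ suc) (λ t → h zero x * ∏ (λ i → h (suc i) (t i))))
      ≡⟨ ∑-cong (λ x → trans
           (cong (w zero x *_) (∑ₜ-*ˡ (w ∘ suc) (h zero x) λ t → ∏ (λ i → h (suc i) (t i))))
           (rearrange (w zero x) (h zero x) _)) ⟩
    ∑ (λ x → h zero x * w zero x * rest)
      ≡⟨ *-distribʳ-sum rest (λ i → h zero (from i) * w zero (from i)) ⟨
    ∑ (λ x → h zero x * w zero x) * rest
      ≡⟨ cong (∑ (λ x → h zero x * w zero x) *_) (∑ₜ-∏ (w ∘ suc) (h ∘ suc)) ⟩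
    ∏ (λ i → ∑ (λ x → h i x * w i x))
      ∎
    where
    open ≡-Reasoning
    rest = ∑ₜ (w ∘ suc) (λ t → ∏ (λ i → h (suc i) (t i)))
    rearrange : ∀ u v x → u * (v * x) ≡ v * u * x
    rearrange = solve-∀

  -- Multiplying out a product of combinations of monomials t^(e i x) adds the exponents along each
  -- tuple. The induction absorbs the exponent from the first factor into `h`.
  pair-∏ₚ : ∀ {m} (f : Fin m → Poly) (w : Fin m → Carrier → ℤ) (e : Fin m → Carrier → ℕ) →
            (∀ i h → pair (f i) h ≡ ∑ (λ x → w i x * h (e i x))) →
            ∀ h → pair (∏ₚ f) h ≡ ∑ₜ w (λ t → h (∑ℕ (λ i → e i (t i))))
  pair-∏ₚ {zero}  f w e eq h = trans (ℤ.+-identityʳ _) (ℤ.*-identityˡ (h 0))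
  pair-∏ₚ {suc m} f w e eq h = trans (pair-* (f zero) (∏ₚ (f ∘ suc)) h) (trans (eq zero _)
    (∑-cong λ x → cong (w zero x *_)
      (pair-∏ₚ (f ∘ suc) (w ∘ suc) (e ∘ suc) (eq ∘ suc) λ j → h (e zero x ℕ.+ j))))

  -- Ranks, and characteristic polynomials as weighted sums.

  module _ (r : Carrier → ℕ) {p} {P : Pred Carrier p} (P? : Decidable P) where

    r≤rankOf : ∀ {x} → P x → r x ℕ.≤ rankOf L r P?
    r≤rankOf {x} Px = All.lookup (xs≤max 0 (map r (filter P? elements)))
      (∈-map⁺ r (∈-filter⁺ P? x∈elements Px))
      where
      x∈elements : x List.∈ elements
      x∈elements = subst (List._∈ elements) (strictlyInverseʳ x) (∈-tabulate⁺ (to x))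

    rankOf-attained : ∀ {y} → P y → ∃[ x ] P x × r x ≡ rankOf L r P?
    rankOf-attained {y} Py with argmax-sel id 0 (map r (filter P? elements))
    -- Here the maximum is the default value 0, so every member has rank 0 and the given `y` attains
    -- it.
    ... | inj₁ max≡0 = y , Py , ℕ.≤-antisym (r≤rankOf Py) (subst (ℕ._≤ r y) (sym max≡0) ℕ.z≤n)
    ... | inj₂ max∈ with ∈-map⁻ r max∈
    ...   | x , x∈ , max≡rx = x , proj₂ (∈-filter⁻ P? {xs = elements} x∈) , sym max≡rx

    -- Brings `χ` into the form that `pair-∏ₚ` expects of each factor.
    pair-χ : ∀ h → pair (χ L r P?) h ≡ ∑ (λ x → 𝟏 (P? x) * μ 0̂ x * h (rankOf L r P? ∸ r x))
    pair-χ h = trans (pair-∑ₚ (λ x → μ 0̂ x ·t^ (rankOf L r P? ∸ r x)) (filter P? elements) h)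
      (trans (∑ℤ-filter-tabulate P? _ from) (∑-cong λ x → trans
        (cong (𝟏 (P? x) *_) (pair-·t^ (μ 0̂ x) (rankOf L r P? ∸ r x) h)) (sym (ℤ.*-assoc (𝟏 (P? x)) (μ 0̂ x) _))))

  -- Tuples from an ideal decomposition.

  module _ (r : Carrier → ℕ) {p m} (I : Fin m → Ideal L p) (dec : IsIdealDecomposition L r I) where
    open IsIdealDecomposition dec

    private
      open module Iᵢ (i : Fin m) = Ideal (I i)

      -- Extension by zero to all of `Carrier` lets every coordinate of a tuple range over the same
      -- type.
      w : Fin m → Carrier → ℤ
      w i x = 𝟏 (member? i x) * μ 0̂ x

      w≢0⇒member : ∀ {i x} → w i x ≢ 0ℤ → member i x
      w≢0⇒member {i} {x} w≢0 with member? i x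
      ... | yes x∈Iᵢ = x∈Iᵢ
      ... | no _     = contradiction (ℤ.*-zeroˡ (μ 0̂ x)) w≢0

      0̂∈ : ∀ i → member i 0̂
      0̂∈ i = downClosed i (minimum _) (proj₂ (nonempty i))

    -- The value 0̂ on tuples outside ∏ᵢ I i is junk.
    join : (Fin m → Carrier) → Carrier
    join t with Fin.all? (λ i → member? i (t i))
    ... | yes t∈I = proj₁ (I2 t t∈I)
    ... | no _    = 0̂

    join-isJoin : ∀ t → (∀ i → member i (t i)) → IsJoin t (join t)
    join-isJoin t t∈I with Fin.all? (λ i → member? i (t i))
    ... | yes t∈I′ = proj₂ (I2 t t∈I′)
    ... | no t∉I   = contradiction t∈I t∉I

    ∏-↓∑-weight : ∀ x → ∏ (λ i → ↓∑ (w i) x) ≡ 𝟏 (x ≟ 0̂)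
    ∏-↓∑-weight x with x ≟ 0̂
    -- At `0̂` each factor has the single term `w i 0̂`, which is 1 because every ideal contains
    -- `0̂`.
    ... | yes refl = trans
      (∏-one _ λ i → trans (↓∑-0̂ (w i)) (cong₂ _*_ (𝟏-true (member? i 0̂) (0̂∈ i)) (μ-refl 0̂)))
      (sym (𝟏-true (0̂ ≟ 0̂) refl))
    ... | no x≢0̂ with I1 x x≢0̂
    ...   | j , y , y≢0̂ , ⊆⟨y⟩ , ⟨y⟩⊆ = trans (∏-zero _ j (begin
      ↓∑ (w j) x  ≡⟨ ∑-cong restrict ⟩
      ↓∑ (μ 0̂) y  ≡⟨ ↓∑-μ y ⟩
      𝟏 (y ≟ 0̂)   ≡⟨ 𝟏-false (y ≟ 0̂) y≢0̂ ⟩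
      0ℤ          ∎)) (sym (𝟏-false (x ≟ 0̂) x≢0̂))
      where
      open ≡-Reasoning
      restrict : ∀ z → 𝟏 (z ≤? x) * w j z ≡ 𝟏 (z ≤? y) * μ 0̂ z
      -- By the choice of `j` and `y`, the members of `I j` below `x` are exactly the elements below
      -- `y`.
      restrict z = begin
        𝟏 (z ≤? x) * (𝟏 (member? j z) * μ 0̂ z)  ≡⟨ rearrange (𝟏 (z ≤? x)) (𝟏 (member? j z)) (μ 0̂ z) ⟩
        𝟏 (member? j z) * 𝟏 (z ≤? x) * μ 0̂ z    ≡⟨ cong (_* μ 0̂ z) (𝟏-× (member? j z) (z ≤? x)) ⟨
        𝟏 (member? j z ×-dec z ≤? x) * μ 0̂ z    ≡⟨ cong (_* μ 0̂ z)
                                                     (𝟏-cong (member? j z ×-dec z ≤? x) (z ≤? y) ⊆⟨y⟩ ⟨y⟩⊆) ⟩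
        𝟏 (z ≤? y) * μ 0̂ z                      ∎
        where
        rearrange : ∀ u v x → u * (v * x) ≡ v * u * x
        rearrange = solve-∀

    -- After passing to `↓∑`, the condition on a tuple is `join t ≤ x`. By the universal property of
    -- the join this splits into one condition per coordinate, so the sum becomes a product.
    μ-join : ∀ x → ∑ₜ w (λ t → 𝟏 (join t ≟ x)) ≡ μ 0̂ x
    μ-join = ↓∑-injective λ x → begin
      ∑ (λ y → 𝟏 (y ≤? x) * ∑ₜ w (λ t → 𝟏 (join t ≟ y)))
        ≡⟨ ∑-cong (λ y → ∑ₜ-*ˡ w (𝟏 (y ≤? x)) λ t → 𝟏 (join t ≟ y)) ⟨
      ∑ (λ y → ∑ₜ w (λ t → 𝟏 (y ≤? x) * 𝟏 (join t ≟ y)))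
        ≡⟨ ∑ₜ-∑ w (λ y t → 𝟏 (y ≤? x) * 𝟏 (join t ≟ y)) ⟩
      ∑ₜ w (λ t → ∑ (λ y → 𝟏 (y ≤? x) * 𝟏 (join t ≟ y)))
        ≡⟨ ∑ₜ-cong w (λ t → trans
             (∑-cong λ y → ℤ.*-comm (𝟏 (y ≤? x)) (𝟏 (join t ≟ y)))
             (∑-δ (join t) λ y → 𝟏 (y ≤? x))) ⟩
      ∑ₜ w (λ t → 𝟏 (join t ≤? x))
        ≡⟨ ∑ₜ-cong-support w (λ t supp → join≤ t x (λ i → w≢0⇒member (supp i))) ⟩
      ∑ₜ w (λ t → ∏ (λ i → 𝟏 (t i ≤? x)))
        ≡⟨ ∑ₜ-∏ w (λ _ y → 𝟏 (y ≤? x)) ⟩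
      ∏ (λ i → ↓∑ (w i) x)
        ≡⟨ ∏-↓∑-weight x ⟩
      𝟏 (x ≟ 0̂)
        ≡⟨ ↓∑-μ x ⟨
      ↓∑ (μ 0̂) x
        ∎
      where
      open ≡-Reasoning
      join≤ : ∀ t x → (∀ i → member i (t i)) → 𝟏 (join t ≤? x) ≡ ∏ (λ i → 𝟏 (t i ≤? x))
      join≤ t x t∈I with join-isJoin t t∈I
      ... | upper , least = trans
        (𝟏-cong (join t ≤? x) (Fin.all? λ i → t i ≤? x) (λ j≤x i → ≤-trans (upper i) j≤x) (least x))
        (∏-𝟏 (λ i → t i ≤? x) (Fin.all? λ i → t i ≤? x))

    private
      R : ℕ
      R = rankOf L r U?

      Rᵢ : Fin m → ℕ
      Rᵢ i = rankOf L r (member? i)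

    -- Choose an element of maximal rank in each ideal; by (I3) their join has rank `∑ℕ Rᵢ`. Hence
    -- `R ∸ ∑ℕ Rᵢ` is not truncated.
    ∑rank≤rank : ∑ℕ Rᵢ ℕ.≤ R
    ∑rank≤rank = subst (ℕ._≤ R)
      (trans (I3 t t∈I (join t) (join-isJoin t t∈I)) (∑ℕ-cong λ i → proj₂ (proj₂ (top i))))
      (r≤rankOf r U? tt)
      where
      top : ∀ i → ∃[ x ] member i x × r x ≡ Rᵢ i
      top i = rankOf-attained r (member? i) (proj₂ (nonempty i))
      t = proj₁ ∘ top
      t∈I = proj₁ ∘ proj₂ ∘ top

    -- Matches the exponents of the two sides of the factorisation. Adding `r (join t)`, expanded by
    -- (I3), turns the right side into `R`; only then is it subtracted.
    corank-join : ∀ t → (∀ i → member i (t i)) →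
                  R ∸ r (join t) ≡ (R ∸ ∑ℕ Rᵢ) ℕ.+ ∑ℕ (λ i → Rᵢ i ∸ r (t i))
    corank-join t t∈I = trans (cong (_∸ r (join t)) (sym total)) (ℕ.m+n∸n≡m _ (r (join t)))
      where
      open ≡-Reasoning
      total : (R ∸ ∑ℕ Rᵢ) ℕ.+ ∑ℕ (λ i → Rᵢ i ∸ r (t i)) ℕ.+ r (join t) ≡ R
      total = begin
        (R ∸ ∑ℕ Rᵢ) ℕ.+ ∑ℕ (λ i → Rᵢ i ∸ r (t i)) ℕ.+ r (join t)
          ≡⟨ cong ((R ∸ ∑ℕ Rᵢ) ℕ.+ ∑ℕ (λ i → Rᵢ i ∸ r (t i)) ℕ.+_) (I3 t t∈I (join t) (join-isJoin t t∈I)) ⟩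
        (R ∸ ∑ℕ Rᵢ) ℕ.+ ∑ℕ (λ i → Rᵢ i ∸ r (t i)) ℕ.+ ∑ℕ (λ i → r (t i))
          ≡⟨ ℕ.+-assoc (R ∸ ∑ℕ Rᵢ) _ _ ⟩
        (R ∸ ∑ℕ Rᵢ) ℕ.+ (∑ℕ (λ i → Rᵢ i ∸ r (t i)) ℕ.+ ∑ℕ (λ i → r (t i)))
          ≡⟨ cong ((R ∸ ∑ℕ Rᵢ) ℕ.+_) (∑ℕ-∸ λ i → r≤rankOf r (member? i) (t∈I i)) ⟩
        (R ∸ ∑ℕ Rᵢ) ℕ.+ ∑ℕ Rᵢ
          ≡⟨ ℕ.m∸n+n≡m ∑rank≤rank ⟩
        R
          ∎

    -- Under an arbitrary functional `h`, both sides become the same sum over tuples: the left by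
    -- `μ-join`, the right by expanding the product.
    χ-factorisation : χ L r U? ≈ₚ t^ (R ∸ ∑ℕ Rᵢ) *ₚ ∏ₚ (λ i → χ L r (member? i))
    χ-factorisation = ≈ₚ-pair {χ L r U?} {t^ (R ∸ ∑ℕ Rᵢ) *ₚ Q} λ h → begin
      pair (χ L r U?) h
        ≡⟨ pair-χ r U? h ⟩
      ∑ (λ x → 1ℤ * μ 0̂ x * h (R ∸ r x))
        ≡⟨ ∑-cong (λ x → cong (_* h (R ∸ r x)) (trans (ℤ.*-identityˡ (μ 0̂ x)) (sym (μ-join x)))) ⟩
      ∑ (λ x → ∑ₜ w (λ t → 𝟏 (join t ≟ x)) * h (R ∸ r x))
        ≡⟨ ∑-cong (λ x → ∑ₜ-*ʳ w (h (R ∸ r x)) λ t → 𝟏 (join t ≟ x)) ⟨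
      ∑ (λ x → ∑ₜ w (λ t → 𝟏 (join t ≟ x) * h (R ∸ r x)))
        ≡⟨ ∑ₜ-∑ w (λ x t → 𝟏 (join t ≟ x) * h (R ∸ r x)) ⟩
      ∑ₜ w (λ t → ∑ (λ x → 𝟏 (join t ≟ x) * h (R ∸ r x)))
        ≡⟨ ∑ₜ-cong w (λ t → ∑-δ (join t) λ x → h (R ∸ r x)) ⟩
      ∑ₜ w (λ t → h (R ∸ r (join t)))
        ≡⟨ ∑ₜ-cong-support w (λ t supp → cong h (corank-join t (λ i → w≢0⇒member (supp i)))) ⟩
      ∑ₜ w (λ t → h ((R ∸ ∑ℕ Rᵢ) ℕ.+ ∑ℕ (λ i → Rᵢ i ∸ r (t i))))
        -- The power of t outside the product acts by shifting the argument of `h`.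
        ≡⟨ pair-∏ₚ (λ i → χ L r (member? i)) w (λ i x → Rᵢ i ∸ r x) (λ i → pair-χ r (member? i))
             (λ j → h ((R ∸ ∑ℕ Rᵢ) ℕ.+ j)) ⟨
      pair Q (λ j → h ((R ∸ ∑ℕ Rᵢ) ℕ.+ j))
        ≡⟨ trans (pair-·t^ 1ℤ (R ∸ ∑ℕ Rᵢ) (λ i → pair Q (λ j → h (i ℕ.+ j)))) (ℤ.*-identityˡ _) ⟨
      pair (t^ (R ∸ ∑ℕ Rᵢ)) (λ i → pair Q (λ j → h (i ℕ.+ j)))
        ≡⟨ pair-* (t^ (R ∸ ∑ℕ Rᵢ)) Q h ⟨
      pair (t^ (R ∸ ∑ℕ Rᵢ) *ₚ Q) h
        ∎
      where
      open ≡-Reasoning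
      Q = ∏ₚ (λ i → χ L r (member? i))

theorem1p1 : ∀ {a ℓ p} (L : FiniteMeetSemilattice a ℓ)
    (r : FiniteMeetSemilattice.Carrier L → ℕ) → IsRank L r →
    ∀ {m} (I : Fin m → Ideal L p) → IsIdealDecomposition L r I →
    ∃[ c ] + c ≡ + rankOf L r U? - + ∑ℕ (λ i → rankOf L r (Ideal.member? (I i)))
         × χ L r U? ≈ₚ t^ c *ₚ ∏ₚ (λ i → χ L r (Ideal.member? (I i)))
theorem1p1 L r _ I dec =
  -- As `S` is at most `R`, the natural difference `R ∸ S` maps to the integer one.
  R ∸ S , trans (sym (ℤ.⊖-≥ (∑rank≤rank L r I dec))) (sym (ℤ.m-n≡m⊖n R S)) , χ-factorisation L r I dec
  where
  R = rankOf L r U?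
  S = ∑ℕ (λ i → rankOf L r (Ideal.member? (I i)))
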